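{- The clique number of the 1-skeleton of the polytope $\operatorname{PSB}(n)$ satisfies $\omega(\operatorname{PSB}(n))=\Theta(n^2)$; that is, there exist constants $c_1,c_2>0$ and $n_0$ such that $c_1 n^2\le \omega(\operatorname{PSB}(n))\le c_2 n^2$ for all $n\ge n_0$.
   Context: Let $K_n=(V,E)$ be the complete directed graph on the vertex set $V=\{1,\dots,n\}$ (cities), with arc set $E$ consisting of all ordered pairs $(u,v)$, $u\neq v$. A Hamiltonian tour $\tau$ is a directed cycle through all cities; $\tau(i)$ denotes the successor of city $i$, $\tau^{ -1}(i)$ its predecessor, and $\tau^{k}(i)$, $\tau^{ -k}(i)$ the $k$-th successor and $k$-th predecessor. A city $i$ is a peak if $\tau^{ -1}(i)<i$ and $\tau(i)<i$. A city $i$ is a step-back peak if either ($\tau^{ -1}(i)<i$, $\tau(i)=i-1$, $\tau^2(i)>i$) or ($\tau^{ -2}(i)>i$, $\tau^{ -1}(i)=i-1$, $\tau(i)<i$). A proper peak is a peak that is not a step-back peak. A pyramidal tour with step-backs is a Hamiltonian tour whose only proper peak is $n$. For a tour $x$, its characteristic vector $\mathbf{v}(x)\in\mathbb{R}^{E}$ has $\mathbf{v}(x)_e=1$ if the arc $e$ is used by $x$ and $0$ otherwise. The polytope of pyramidal tours with step-backs is $\operatorname{PSB}(n)=\operatorname{conv}\{\mathbf{v}(x) : x \text{ is a pyramidal tour with step-backs in } K_n\}$. The 1-skeleton of a polytope is the graph whose vertices are the vertices of the polytope and whose edges are the one-dimensional faces (geometric edges) of the polytope. $\omega(\operatorname{PSB}(n))$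 denotes the clique number of this 1-skeleton, i.e. the maximum number of pairwise adjacent vertices of $\operatorname{PSB}(n)$.
   Formalization: The edges of the polytope are taken to be those exposed by linear functionals with rational rather than real coefficients; since the vertices are 0/1 vectors, this gives the same 1-skeleton. -}

module Defs where

open import Data.Nat using (ℕ; zero; suc; _∸_) renaming (_+_ to _+ℕ_)
open import Data.Fin using (Fin; toℕ; _<_)
open import Data.List using (List; foldr; map)
open import Data.List using () renaming (allFin to allFinL)
open import Data.Rational using (ℚ; 0ℚ) renaming (_+_ to _+ℚ_; _<_ to _<ℚ_)
open import Data.Product using (Σ; ∃; _×_; _,_; proj₁)
open import Data.Sum using (_⊎_)
open import Relation.Binary.PropositionalEquality using (_≡_; _≢_)
open import Relation.Nullary using (¬_)

iter : {A : Set} → (A → A) → ℕ → A → A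
iter f zero    a = a
iter f (suc k) a = f (iter f k a)

-- A Hamiltonian (directed) tour on the cities Fin n
-- (city i : Fin n corresponds to city toℕ i + 1 of the paper; the order is the same).
-- succ = τ, pred = τ⁻¹; the tour is a single cycle visiting every city.
record Tour (n : ℕ) : Set where
  field
    succ  : Fin n → Fin n
    pred  : Fin n → Fin n
    succ-pred : ∀ i → succ (pred i) ≡ i
    pred-succ : ∀ i → pred (succ i) ≡ i
    hamiltonian : ∀ i j → ∃ λ k → iter succ k i ≡ j
open Tour public

-- Two tours are the same tour iff they have the same successor function,
-- i.e. iff they have the same characteristic vector.
SameTour : ∀ {n} → Tour n → Tour n → Set
SameTour x y = ∀ u → succ x u ≡ succ y u

module _ {n : ℕ} (t : Tour n) where
  Peak : Fin n → Set
  Peak i = pred t i < i × succ t i < i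

  StepBackPeak : Fin n → Set
  StepBackPeak i =
      (pred t i < i × toℕ (succ t i) +ℕ 1 ≡ toℕ i × i < succ t (succ t i))
    ⊎ (i < pred t (pred t i) × toℕ (pred t i) +ℕ 1 ≡ toℕ i × succ t i < i)

  ProperPeak : Fin n → Set
  ProperPeak i = Peak i × ¬ StepBackPeak i

  -- pyramidal tour with step-backs: the only proper peak is the largest city n
  IsPSBTour : Set
  IsPSBTour = ∀ i → ProperPeak i → toℕ i +ℕ 1 ≡ n

PSBTour : ℕ → Set
PSBTour n = Σ (Tour n) IsPSBTour

-- a linear objective on ℚ^E (arcs (u,v); diagonal entries are never used)
Objective : ℕ → Set
Objective n = Fin n → Fin n → ℚ

-- c · v(x) = Σ_u c(u, τ(u))
value : ∀ {n} → Objective n → Tour n → ℚ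
value {n} c x = foldr _+ℚ_ 0ℚ (map (λ u → c u (succ x u)) (allFinL n))

-- Adjacency in the 1-skeleton of PSB(n): the segment [v(x),v(y)] is a face,
-- i.e. some linear functional is maximized over the vertices exactly at v(x), v(y).
Adjacent : ∀ {n} → PSBTour n → PSBTour n → Set
Adjacent {n} (x , _) (y , _) =
  ¬ SameTour x y ×
  ∃ λ (c : Objective n) →
    value c x ≡ value c y ×
    (∀ (z : PSBTour n) → ¬ SameTour (proj₁ z) x → ¬ SameTour (proj₁ z) y →
       value c (proj₁ z) <ℚ value c x)

Clique : (n m : ℕ) → Set
Clique n m = Σ (Fin m → PSBTour n) λ f → ∀ i j → i ≢ j → Adjacent (f i) (f j)

{-# OPTIONS --safe #-}
module Submission where

-- Upper bound. Cut a tour between the cities below i and the others. If two tours have the same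
-- cities with arcs crossing the cut, exchanging their lower parts gives two tours of the same
-- kind with the same total characteristic vector: a fixed-point-free permutation whose only
-- proper peak is the largest city is automatically a single cycle, as every cycle contains its
-- own maximum. Hence two adjacent tours with the same cut agree below it or above it, so for
-- each type of cut either all tours of a clique having it agree below it, or all agree above it.
-- A tour is then determined by its last cut of the first kind together with the next cut, which
-- is of the second kind. There are O(n) possibilities for each i, because at most one end of a
-- crossing arc is further than 3 from the cut.
--
-- Lower bound. Consider the tours that descend along n, b, a, 1 and visit all other cities on
-- the way up, with a in the lower and b in the upper half. When the positions are spaced by at
-- least 2, the permutation y⁻¹x of two such tours has a single nontrivial cycle, so x and y are
-- the only permutations using arcs of x and y alone.

open import Defs
open import Algebra.Bundles using (CommutativeMonoid)
open import Data.Fin using (Fin; toℕ; fromℕ<; combine; remQuot; funToFin)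
import Data.Fin as Fin
open import Data.Fin.Patterns using (0F; 1F; 2F; 3F)
import Data.Fin.Properties as Fin
open import Data.List using (List; []; _∷_; foldr; map; allFin)
open import Data.List.Membership.Propositional using (_∈_)
open import Data.List.Membership.Propositional.Properties using (∈-allFin)
open import Data.List.Relation.Unary.Any using (here; there)
open import Data.Nat using (ℕ; zero; suc; _+_; _*_; _∸_; _^_; _≤_; _<_; z≤n; s≤s; NonZero)
import Data.Nat as ℕ using (pred)
open import Data.Nat.DivMod using (_/_; _%_; m≡m%n+[m/n]*n; m%n<n; m/n*n≤m; m≥n⇒m/n>0)
open import Data.Nat.Induction using (<-rec)
import Data.Nat.Properties as ℕ
open import Data.Nat.Tactic.RingSolver using (solve-∀)
open import Data.Product using (∃; _×_; _,_; proj₁; proj₂)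
import Data.Product as Product
import Data.Rational as ℚ
import Data.Rational.Properties as ℚ
open import Data.Sum using (_⊎_; inj₁; inj₂; swap; [_,_]′)
import Data.Sum as Sum
open import Data.Empty using (⊥-elim)
open import Function using (_∘_; id; case_of_)
open import Relation.Nullary using (¬_; Dec; yes; no; contradiction; ¬?; _×-dec_; _⊎-dec_; _→-dec_)
open import Relation.Nullary.Decidable using (decidable-stable; toWitness)
open import Relation.Binary.PropositionalEquality
  using (_≡_; _≢_; _≗_; refl; sym; trans; cong; cong₂; subst; subst₂; ≢-sym)
open import Algebra.Properties.CommutativeSemigroup
  (CommutativeMonoid.commutativeSemigroup ℚ.+-0-commutativeMonoid) using (interchange)

private variable
  n : ℕ

-- Pyramidal tours as permutations without fixed points

Injective : (Fin n → Fin n) → Set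
Injective f = ∀ {u v} → f u ≡ f v → u ≡ v

Back : (Fin n → Fin n) → Fin n → Set
Back f u = toℕ (f u) + 1 ≡ toℕ u × toℕ u < toℕ (f (f u))

-- Hamiltonicity is left out: it follows from the condition on the peaks (see reach).
record Pyramid (n : ℕ) : Set where
  field
    next prev : Fin n → Fin n
    next-prev : ∀ u → next (prev u) ≡ u
    prev-next : ∀ u → prev (next u) ≡ u
    next≢     : ∀ u → next u ≢ u
    peaks     : ∀ u → suc (toℕ u) ≢ n → toℕ (prev u) < toℕ u → toℕ (next u) < toℕ u →
                  Back next u ⊎ Back prev u

  next-injective : Injective next
  next-injective {u} {v} e = trans (sym (prev-next u)) (trans (cong prev e) (prev-next v))

  prev≢ : ∀ u → prev u ≢ u
  prev≢ u e = next≢ u (trans (cong next (sym e)) (next-prev u))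

  next⇒prev : ∀ {u v} → next u ≡ v → prev v ≡ u
  next⇒prev {u} refl = prev-next u

  prev⇒next : ∀ {u v} → prev v ≡ u → next u ≡ v
  prev⇒next {v = v} refl = next-prev v

open Pyramid

rev : Pyramid n → Pyramid n
rev t = record
  { next = prev t ; prev = next t ; next-prev = prev-next t ; prev-next = next-prev t
  ; next≢ = prev≢ t ; peaks = λ u h p q → swap (peaks t u h q p) }

≢∧≮⇒> : ∀ {u v : Fin n} → u ≢ v → ¬ toℕ u < toℕ v → toℕ v < toℕ u
≢∧≮⇒> u≢v u≮v = ℕ.≤∧≢⇒< (ℕ.≮⇒≥ u≮v) (u≢v ∘ sym ∘ Fin.toℕ-injective)

iter-+ : ∀ {A : Set} (f : A → A) j k a → iter f (j + k) a ≡ iter f j (iter f k a)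
iter-+ f zero    k a = refl
iter-+ f (suc j) k a = cong f (iter-+ f j k a)

Reach : (Fin n → Fin n) → Fin n → Fin n → Set
Reach f u v = ∃ λ k → iter f k u ≡ v

Reach-trans : ∀ {f : Fin n → Fin n} {u v w} → Reach f u v → Reach f v w → Reach f u w
Reach-trans {f = f} {u} (j , refl) (k , refl) = k + j , iter-+ f k j u

iter-injective : ∀ {f : Fin n → Fin n} → Injective f → ∀ k → Injective (iter f k)
iter-injective inj zero    e = e
iter-injective inj (suc k) e = iter-injective inj k (inj e)

period : ∀ {f : Fin n → Fin n} → Injective f → ∀ u → ∃ λ k → iter f (suc k) u ≡ u
period {n} {f} inj u
  with i , j , i<j , e ← Fin.pigeonhole (ℕ.n<1+n n) (λ (k : Fin (suc n)) → iter f (toℕ k) u)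
  = d , sym (iter-injective inj (toℕ i)
      (trans e (trans (cong (λ k → iter f k u) (sym sum≡j)) (iter-+ f (toℕ i) (suc d) u))))
  where
  d = toℕ j ∸ suc (toℕ i)
  sum≡j : toℕ i + suc d ≡ toℕ j
  sum≡j = trans (ℕ.+-suc (toℕ i) d) (ℕ.m+[n∸m]≡n i<j)

module _ (t : Pyramid n) where

  reach-prev : ∀ u → Reach (next t) u (prev t u)
  reach-prev u with k , e ← period (next-injective t) u = k , sym (next⇒prev t e)

  Reach-sym : ∀ {u v} → Reach (next t) u v → Reach (next t) v u
  Reach-sym {u} (zero  , refl) = 0 , refl
  Reach-sym {u} (suc k , refl) = Reach-trans
    (subst (Reach (next t) _) (prev-next t _) (reach-prev _)) (Reach-sym (k , refl))

  -- A city without a larger neighbour is a peak, hence a step-back peak, and the second condition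
  -- of `Back` supplies a larger city two steps away on the same cycle.
  ascend : ∀ u → suc (toℕ u) ≢ n → ∃ λ v → toℕ u < toℕ v × Reach (next t) u v
  ascend u h with toℕ (next t u) ℕ.<? toℕ u | toℕ (prev t u) ℕ.<? toℕ u
  ... | no q  | _     = next t u , ≢∧≮⇒> (next≢ t u) q , 1 , refl
  ... | yes _ | no p  = prev t u , ≢∧≮⇒> (prev≢ t u) p , reach-prev u
  ... | yes q | yes p with peaks t u h p q
  ...   | inj₁ (_ , l) = next t (next t u) , l , 2 , refl
  ...   | inj₂ (_ , l) = prev t (prev t u) , l , Reach-trans (reach-prev u) (reach-prev _)

  reach-top : ∀ d u → toℕ u + suc d ≡ n → ∃ λ v → suc (toℕ v) ≡ n × Reach (next t) u v
  reach-top = <-rec _ step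
    where
    ReachesTop : ℕ → Set
    ReachesTop d = ∀ u → toℕ u + suc d ≡ n → ∃ λ v → suc (toℕ v) ≡ n × Reach (next t) u v

    step : ∀ d → (∀ {e} → e < d → ReachesTop e) → ReachesTop d
    step d ih u eq with suc (toℕ u) ℕ.≟ n
    ... | yes p = u , p , 0 , refl
    ... | no h with v , u<v , r ← ascend u h =
      let e    = n ∸ suc (toℕ v)
          v+e  : toℕ v + suc e ≡ n
          v+e  = trans (ℕ.+-suc (toℕ v) e) (ℕ.m+[n∸m]≡n (Fin.toℕ<n v))
          e<d  : e < d
          e<d  = ℕ.≤-pred (ℕ.+-cancelˡ-< (toℕ u) (suc e) (suc d)
                   (subst (toℕ u + suc e <_) (trans v+e (sym eq)) (ℕ.+-monoˡ-< (suc e) u<v)))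
          w , top , r′ = ih e<d v v+e
      in w , top , Reach-trans r r′

  -- Both cities lie on the cycle of the largest city, and reachability along a finite cycle is
  -- symmetric.
  reach : ∀ u v → Reach (next t) u v
  reach u v
    with u′ , p , r ← reach-top (n ∸ suc (toℕ u)) u (trans (ℕ.+-suc (toℕ u) _) (ℕ.m+[n∸m]≡n (Fin.toℕ<n u)))
       | v′ , q , s ← reach-top (n ∸ suc (toℕ v)) v (trans (ℕ.+-suc (toℕ v) _) (ℕ.m+[n∸m]≡n (Fin.toℕ<n v)))
    with refl ← Fin.toℕ-injective {i = u′} {v′} (ℕ.suc-injective (trans p (sym q)))
    = Reach-trans r (Reach-sym s)

toPSB : Pyramid n → PSBTour n
toPSB {n} t = tour , only-top
  where
  tour : Tour n
  tour = record
    { succ = next t ; pred = prev t ; succ-pred = next-prev t ; pred-succ = prev-next t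
    ; hamiltonian = reach t }

  only-top : IsPSBTour tour
  only-top u ((p , q) , ¬sb) = trans (ℕ.+-comm (toℕ u) 1)
    (decidable-stable (suc (toℕ u) ℕ.≟ n) λ h → ¬sb
      ([ (λ (e , l) → inj₁ (p , e , l)) , (λ (e , l) → inj₂ (l , e , q)) ]′ (peaks t u h p q)))

-- At least two cities are required because the only city of a one-city tour is its own successor.
fromPSB : PSBTour (2 + n) → Pyramid (2 + n)
fromPSB {n} (t , only-top) = record
  { next = succ t ; prev = pred t ; next-prev = succ-pred t ; prev-next = pred-succ t
  ; next≢ = moves ; peaks = sb }
  where
  fixed : ∀ u → succ t u ≡ u → ∀ k → iter (succ t) k u ≡ u
  fixed u e zero    = refl
  fixed u e (suc k) = trans (cong (succ t) (fixed u e k)) e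

  moves : ∀ u → succ t u ≢ u
  moves u e with k , r ← hamiltonian t u (Fin.punchIn u Fin.zero) =
    Fin.punchInᵢ≢i u Fin.zero (trans (sym r) (fixed u e k))

  -- The condition on proper peaks only refutes the absence of a step-back; decidability extracts
  -- one.
  stepBack? : ∀ u → Dec (StepBackPeak t u)
  stepBack? u =
        ((_ ℕ.<? _) ×-dec (_ ℕ.≟ _) ×-dec (_ ℕ.<? _))
    ⊎-dec ((_ ℕ.<? _) ×-dec (_ ℕ.≟ _) ×-dec (_ ℕ.<? _))

  sb : ∀ u → suc (toℕ u) ≢ 2 + n → toℕ (pred t u) < toℕ u → toℕ (succ t u) < toℕ u →
         Back (succ t) u ⊎ Back (pred t) u
  sb u h p q with decidable-stable (stepBack? u)
    (λ ¬sb → h (trans (ℕ.+-comm 1 (toℕ u)) (only-top u ((p , q) , ¬sb))))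
  ... | inj₁ (_ , e , l) = inj₁ (e , l)
  ... | inj₂ (l , e , _) = inj₂ (e , l)

-- Cuts and exchange of tails

-- The cut i separates the cities 0, …, i − 1 from the others.
Low : Pyramid n → ℕ → Fin n → Set
Low t i u = toℕ u < i × toℕ (next t u) < i

low? : ∀ (t : Pyramid n) i u → Dec (Low t i u)
low? t i u = (toℕ u ℕ.<? i) ×-dec (toℕ (next t u) ℕ.<? i)

LowEquiv : ℕ → Pyramid n → Pyramid n → Set
LowEquiv i x y = ∀ u → (Low x i u → Low y i u) × (Low y i u → Low x i u)

-- A lower city whose arc is not low sends it across the cut. So both tours have the same lower
-- cities as tails and the same as heads of crossing arcs, while the upper ends may differ.
SameCut : ℕ → Pyramid n → Pyramid n → Set
SameCut i x y = LowEquiv i x y × LowEquiv i (rev x) (rev y)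

sameCut? : ∀ i (x y : Pyramid n) → Dec (SameCut i x y)
sameCut? i x y = lowEquiv? x y ×-dec lowEquiv? (rev x) (rev y)
  where
  lowEquiv? : ∀ s t → Dec (LowEquiv i s t)
  lowEquiv? s t = Fin.all? λ u → (low? s i u →-dec low? t i u) ×-dec (low? t i u →-dec low? s i u)

SameCut-sym : ∀ {i} {x y : Pyramid n} → SameCut i x y → SameCut i y x
SameCut-sym (e , e′) = Product.swap ∘ e , Product.swap ∘ e′

SameCut-trans : ∀ {i} {x y z : Pyramid n} → SameCut i x y → SameCut i y z → SameCut i x z
SameCut-trans {n} (e , e′) (f , f′) = comp e f , comp e′ f′
  where
  comp : ∀ {A B C : Fin n → Set} → (∀ u → (A u → B u) × (B u → A u)) → (∀ u → (B u → C u) × (C u → B u))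
       → ∀ u → (A u → C u) × (C u → A u)
  comp p q u = proj₁ (q u) ∘ proj₁ (p u) , proj₂ (p u) ∘ proj₂ (q u)

AgreeBelow AgreeAbove : ℕ → Pyramid n → Pyramid n → Set
AgreeBelow i x y = ∀ u → Low x i u → next x u ≡ next y u
AgreeAbove i x y = ∀ u → ¬ Low x i u → next x u ≡ next y u

agreeBelow? : ∀ i (x y : Pyramid n) → Dec (AgreeBelow i x y)
agreeBelow? i x y = Fin.all? λ u → low? x i u →-dec next x u Fin.≟ next y u

agreeAbove? : ∀ i (x y : Pyramid n) → Dec (AgreeAbove i x y)
agreeAbove? i x y = Fin.all? λ u → ¬? (low? x i u) →-dec next x u Fin.≟ next y u

choose : ∀ {P A : Set} → Dec P → A → A → A
choose (yes _) a b = a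
choose (no _)  a b = b

choose-yes : ∀ {P A : Set} (p? : Dec P) {a b : A} → P → choose p? a b ≡ a
choose-yes (yes _) p = refl
choose-yes (no ¬p) p = contradiction p ¬p

choose-no : ∀ {P A : Set} (p? : Dec P) {a b : A} → ¬ P → choose p? a b ≡ b
choose-no (yes p) ¬p = contradiction p ¬p
choose-no (no _)  ¬p = refl

-- Crossing arcs count as upper ones and are taken from `y`.
glueNext : ℕ → Pyramid n → Pyramid n → Fin n → Fin n
glueNext i x y u = choose (low? x i u) (next x u) (next y u)

module _ {i : ℕ} where

  glueNext-low : ∀ (x y : Pyramid n) {u} → Low x i u → glueNext i x y u ≡ next x u
  glueNext-low x y {u} = choose-yes (low? x i u)

  glueNext-high : ∀ (x y : Pyramid n) {u} → ¬ Low x i u → glueNext i x y u ≡ next y u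
  glueNext-high x y {u} = choose-no (low? x i u)

  -- The delicate case is an arc taken from `y`: were its reversal low in `rev x`, it would be low
  -- in `rev y` by `e′`, and then `u` would be low in `x` by `e`.
  glue-inverse : ∀ {x y : Pyramid n} → SameCut i x y →
    ∀ u → glueNext i (rev x) (rev y) (glueNext i x y u) ≡ u
  glue-inverse {x = x} {y} (e , e′) u = case low? x i u of λ where
    (yes lo@(u<i , v<i)) →
      trans (cong (glueNext i (rev x) (rev y)) (glueNext-low x y lo))
     (trans (glueNext-low (rev x) (rev y) (v<i , subst (λ w → toℕ w < i) (sym (prev-next x u)) u<i))
            (prev-next x u))
    (no ¬lo) →
      trans (cong (glueNext i (rev x) (rev y)) (glueNext-high x y ¬lo))
     (trans (glueNext-high (rev x) (rev y) λ lo →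
               let v<i , u<i = proj₁ (e′ (next y u)) lo
               in ¬lo (proj₂ (e u) (subst (λ w → toℕ w < i) (prev-next y u) u<i , v<i)))
            (prev-next y u))

  glue-moves : ∀ {x y : Pyramid n} u → glueNext i x y u ≢ u
  glue-moves {x = x} {y} u e = case low? x i u of λ where
    (yes lo) → next≢ x u (trans (sym (glueNext-low x y lo)) e)
    (no ¬lo) → next≢ y u (trans (sym (glueNext-high x y ¬lo)) e)

  module _ {n} {x y : Pyramid n} (same : LowEquiv i x y) where
    private
      g = glueNext i x y

    -- An arc descending from a lower city stays below the cut. If it came from `y`, then `u` would
    -- be low in `y` and hence in `x`.
    glue-below : ∀ {u} → toℕ u < i → toℕ (g u) < toℕ u → g u ≡ next x u
    glue-below {u} u<i gu<u = glueNext-low x y (decidable-stable (low? x i u) λ ¬l →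
      ¬l (proj₂ (same u) (u<i ,
        ℕ.<-trans (subst (λ w → toℕ w < toℕ u) (glueNext-high x y ¬l) gu<u) u<i)))

    glue-above : ∀ {u} → ¬ toℕ u < i → g u ≡ next y u
    glue-above {u} u≮i = glueNext-high x y (u≮i ∘ proj₁)

    -- Below the cut only crossing arcs are replaced, and the replacement crosses too, so it still
    -- ends above `u`. This preserves the second condition of `Back`.
    glue-jump-below : ∀ {u w : Fin n} → toℕ u < i → toℕ w < i → toℕ u < toℕ (next x w) → toℕ u < toℕ (g w)
    glue-jump-below {u} {w} u<i w<i l = case low? x i w of λ where
      (yes lo) → subst (λ v → toℕ u < toℕ v) (sym (glueNext-low x y lo)) l
      (no ¬lo) → subst (λ v → toℕ u < toℕ v) (sym (glueNext-high x y ¬lo))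
        (ℕ.<-≤-trans u<i (ℕ.≮⇒≥ λ l′ → ¬lo (proj₂ (same w) (w<i , l′))))

    glue-jump-above : ∀ {u w : Fin n} → ¬ toℕ u < i → toℕ u < toℕ (next y w) → toℕ u < toℕ (g w)
    glue-jump-above {u} {w} u≮i l = subst (λ v → toℕ u < toℕ v) (sym (glueNext-high x y
      λ lo → u≮i (ℕ.<-trans l (proj₂ (proj₁ (same w) lo))))) l

    glue-back-below : ∀ {u} → toℕ u < i → toℕ (g u) < toℕ u → Back (next x) u → Back g u
    glue-back-below {u} u<i gu<u (p , q) =
        subst (λ w → toℕ w + 1 ≡ toℕ u) (sym e) p
      , subst (λ w → toℕ u < toℕ (g w)) (sym e)
          (glue-jump-below u<i (subst (λ w → toℕ w < i) e (ℕ.<-trans gu<u u<i)) q)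
      where e = glue-below u<i gu<u

    glue-back-above : ∀ {u} → ¬ toℕ u < i → Back (next y) u → Back g u
    glue-back-above {u} u≮i (p , q) =
        subst (λ w → toℕ w + 1 ≡ toℕ u) (sym e) p
      , subst (λ w → toℕ u < toℕ (g w)) (sym e) (glue-jump-above u≮i q)
      where e = glue-above u≮i

  -- A peak of the glued permutation has the same neighbours in `x` or in `y`, according to its
  -- side. It is a step-back peak there, and the step-back survives the exchange.
  glue : (x y : Pyramid n) → SameCut i x y → Pyramid n
  glue {n} x y (e , e′) = record
    { next = g ; prev = g′
    ; next-prev = glue-inverse {x = rev x} {rev y} (e′ , e)
    ; prev-next = glue-inverse {x = x} {y} (e , e′)
    ; next≢ = glue-moves {x = x} {y} ; peaks = back }
    where
    g g′ : Fin n → Fin n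
    g  = glueNext i x y
    g′ = glueNext i (rev x) (rev y)

    back : ∀ u → suc (toℕ u) ≢ n → toℕ (g′ u) < toℕ u → toℕ (g u) < toℕ u → Back g u ⊎ Back g′ u
    back u h p q = case toℕ u ℕ.<? i of λ where
      (yes u<i) → Sum.map
        (glue-back-below {x = x} {y} e u<i q) (glue-back-below {x = rev x} {rev y} e′ u<i p)
        (peaks x u h
          (subst (λ w → toℕ w < toℕ u) (glue-below {x = rev x} {rev y} e′ u<i p) p)
          (subst (λ w → toℕ w < toℕ u) (glue-below {x = x} {y} e u<i q) q))
      (no u≮i) → Sum.map
        (glue-back-above {x = x} {y} e u≮i) (glue-back-above {x = rev x} {rev y} e′ u≮i)
        (peaks y u h
          (subst (λ w → toℕ w < toℕ u) (glue-above {x = rev x} {rev y} e′ u≮i) p)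
          (subst (λ w → toℕ w < toℕ u) (glue-above {x = x} {y} e u≮i) q))

-- Here `u` is the lower end of a crossing arc: its tail for `t`, its head for `rev t`.
Out : Pyramid n → ℕ → Fin n → Set
Out t i u = toℕ u < i × i ≤ toℕ (next t u)

out? : ∀ (t : Pyramid n) i u → Dec (Out t i u)
out? t i u = (toℕ u ℕ.<? i) ×-dec (i ℕ.≤? toℕ (next t u))

AtMostOne : (Fin n → Set) → Set
AtMostOne P = ∀ {u v} → P u → P v → u ≡ v

-- One path below the cut, or two of which one is the single city i − 1.
data Shape (t : Pyramid n) (i : ℕ) : Set where
  one : AtMostOne (Out t i) → AtMostOne (Out (rev t) i) → Shape t i
  two : ∀ c → suc (toℕ c) ≡ i → Out t i c → Out (rev t) i c →
        AtMostOne (λ u → Out t i u × u ≢ c) → AtMostOne (λ u → Out (rev t) i u × u ≢ c) → Shape t i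

Shape-rev : ∀ {t : Pyramid n} {i} → Shape (rev t) i → Shape t i
Shape-rev (one p q)           = one q p
Shape-rev (two c e o o′ p q) = two c e o′ o q p

module _ (t : Pyramid n) (c : Fin n) where
  private
    i = toℕ c

  Out-suc : ∀ {u} → Out t i u → next t u ≢ c → Out t (suc i) u
  Out-suc (u<i , l) h = ℕ.m<n⇒m<1+n u<i , ℕ.≤∧≢⇒< l (h ∘ sym ∘ Fin.toℕ-injective)

  Out-self : ¬ toℕ (next t c) < i → Out t (suc i) c
  Out-self h = ℕ.n<1+n i , ≢∧≮⇒> (next≢ t c) h

  -- Lowering the cut past c, the arc into c is the only new one leaving the lower side.
  one-down : AtMostOne (Out t (suc i)) → (toℕ (next t c) < i → ¬ toℕ (prev t c) < i) → AtMostOne (Out t i)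
  one-down U h {u} {v} ou ov with next t u Fin.≟ c | next t v Fin.≟ c
  ... | yes p | yes q = next-injective t (trans p (sym q))
  ... | no p  | no q  = U (Out-suc ou p) (Out-suc ov q)
  ... | yes p | no q  = contradiction (subst (λ w → toℕ w < i) (sym (next⇒prev t p)) (proj₁ ou))
                          (h (ℕ.≰⇒> λ l → contradiction (proj₁ ov) (ℕ.<-irrefl (cong toℕ
                            (U (Out-suc ov q) (Out-self (ℕ.≤⇒≯ l)))))))
  ... | no p  | yes q = contradiction (subst (λ w → toℕ w < i) (sym (next⇒prev t q)) (proj₁ ov))
                          (h (ℕ.≰⇒> λ l → contradiction (proj₁ ou) (ℕ.<-irrefl (cong toℕ
                            (U (Out-suc ou p) (Out-self (ℕ.≤⇒≯ l)))))))

-- Arcs crossing a cut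

-- As `c` is entered from above, no lower city precedes it. So the arcs leaving across the lowered
-- cut already left across the old one, from cities other than `c`.
two-down : ∀ (t : Pyramid n) c → Out (rev t) (suc (toℕ c)) c →
  AtMostOne (λ u → Out t (suc (toℕ c)) u × u ≢ c) → AtMostOne (Out t (toℕ c))
two-down t c (_ , c<p) V {u} {v} ou ov = V (lift ou) (lift ov)
  where
  lift : ∀ {u} → Out t (toℕ c) u → Out t (suc (toℕ c)) u × u ≢ c
  lift o@(u<c , _) =
      Out-suc t c o (λ e → ℕ.<-asym u<c (subst (λ w → toℕ c < toℕ w) (next⇒prev t e) c<p))
    , λ e → ℕ.<-irrefl (cong toℕ e) u<c

-- The tour goes from `c` to `s`, the city just below, and then above `c`, so lowering the cut past
-- `c` isolates `s`. The arc from `s` was the only one leaving the old lower side; any other one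
-- leaving now must end in `c`.
peak-down : ∀ (t : Pyramid n) c → toℕ (next t c) < toℕ c → Back (next t) c →
  AtMostOne (Out t (suc (toℕ c))) → AtMostOne (Out (rev t) (suc (toℕ c))) → Shape t (toℕ c)
peak-down t c q (e , l) U U′ = two s s+1 (q , ℕ.<⇒≤ l) (q , ℕ.≤-reflexive (cong toℕ (sym (prev-next t c)))) V V′
  where
  s = next t c
  s+1 : suc (toℕ s) ≡ toℕ c
  s+1 = trans (ℕ.+-comm 1 (toℕ s)) e

  into-c : ∀ {u} → Out t (toℕ c) u → u ≢ s → next t u ≡ c
  into-c {u} o u≢s = decidable-stable (next t u Fin.≟ c) λ h →
    u≢s (U (Out-suc t c o h) (ℕ.m<n⇒m<1+n q , l))

  V : AtMostOne (λ u → Out t (toℕ c) u × u ≢ s)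
  V (o , h) (o′ , h′) = next-injective t (trans (into-c o h) (sym (into-c o′ h′)))

  not-from-c : ∀ {u} → Out (rev t) (toℕ c) u → u ≢ s → Out (rev t) (suc (toℕ c)) u
  not-from-c o u≢s = Out-suc (rev t) c o λ h → u≢s (sym (prev⇒next t h))

  V′ : AtMostOne (λ u → Out (rev t) (toℕ c) u × u ≢ s)
  V′ (o , h) (o′ , h′) = U′ (not-from-c o h) (not-from-c o′ h′)

-- Two paths become one when the isolated city is removed. One path can split only if both
-- neighbours of `c` lie below it, and then `c` is a step-back peak.
shape-down : ∀ (t : Pyramid n) c → suc (toℕ c) ≢ n → Shape t (suc (toℕ c)) → Shape t (toℕ c)
shape-down t c h (two d e o o′ V V′) with refl ← Fin.toℕ-injective {i = d} {c} (ℕ.suc-injective e) =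
  one (two-down t c o′ V) (two-down (rev t) c o V′)
shape-down t c h (one U U′) = case (toℕ (prev t c) ℕ.<? toℕ c) ×-dec (toℕ (next t c) ℕ.<? toℕ c) of λ where
  (no ¬peak) → one (one-down t c U λ q p → ¬peak (p , q)) (one-down (rev t) c U′ λ p q → ¬peak (p , q))
  (yes (p , q)) → case peaks t c h p q of λ where
    (inj₁ b) → peak-down t c q b U U′
    (inj₂ b) → Shape-rev {t = t} (peak-down (rev t) c p b U′ U)

shape-top : ∀ (t : Pyramid n) c → suc (toℕ c) ≡ n → Shape t (toℕ c)
shape-top {n} t c top = one (U t) (U (rev t))
  where
  U : ∀ s → AtMostOne (Out s (toℕ c))
  U s o o′ = next-injective s (trans (into-c o) (sym (into-c o′)))
    where
    into-c : ∀ {u} → Out s (toℕ c) u → next s u ≡ c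
    into-c {u} (_ , l) = Fin.toℕ-injective (ℕ.≤-antisym
      (ℕ.≤-pred (subst (suc (toℕ (next s u)) ≤_) (sym top) (Fin.toℕ<n (next s u)))) l)

shape : ∀ (t : Pyramid n) c → Shape t (toℕ c)
shape {n} t c = go (n ∸ suc (toℕ c)) c (ℕ.m+[n∸m]≡n (Fin.toℕ<n c))
  where
  go : ∀ k c → suc (toℕ c) + k ≡ n → Shape t (toℕ c)
  go zero    c e = shape-top t c (trans (sym (ℕ.+-identityʳ _)) e)
  go (suc k) c e = shape-down t c (ℕ.<⇒≢ c+1<n)
    (subst (Shape t) (Fin.toℕ-fromℕ< c+1<n)
      (go k (fromℕ< c+1<n) (trans (cong (λ w → suc w + k) (Fin.toℕ-fromℕ< c+1<n)) (trans (sym (ℕ.+-suc _ k)) e))))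
    where
    c+1<n : suc (toℕ c) < n
    c+1<n = ℕ.≤-trans (ℕ.m≤m+n _ k) (ℕ.≤-reflexive (trans (sym (ℕ.+-suc _ k)) e))

-- Either an arc at `c` goes up, and `c` is the only lower end in that direction, or `c` is a
-- step-back peak and the city just below it is such an end.
near-one : ∀ (t : Pyramid n) c → suc (toℕ c) ≢ n →
  AtMostOne (Out t (suc (toℕ c))) → AtMostOne (Out (rev t) (suc (toℕ c))) →
    (∀ u → Out t (suc (toℕ c)) u → toℕ c ≤ 1 + toℕ u)
  ⊎ (∀ u → Out (rev t) (suc (toℕ c)) u → toℕ c ≤ 1 + toℕ u)
near-one t c h U U′ = case (toℕ (next t c) ℕ.<? toℕ c) of λ where
    (no ¬q) → inj₁ (near U (Out-self t c ¬q) (ℕ.n≤1+n _))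
    (yes q) → case (toℕ (prev t c) ℕ.<? toℕ c) of λ where
      (no ¬p) → inj₂ (near U′ (Out-self (rev t) c ¬p) (ℕ.n≤1+n _))
      (yes p) → Sum.map (back t U q) (back (rev t) U′ p) (peaks t c h p q)
  where
  near : ∀ {P : Fin _ → Set} → AtMostOne P → ∀ {v} → P v → toℕ c ≤ 1 + toℕ v → ∀ u → P u → toℕ c ≤ 1 + toℕ u
  near U p l u p′ = subst (λ w → toℕ c ≤ 1 + toℕ w) (U p p′) l

  back : ∀ s → AtMostOne (Out s (suc (toℕ c))) → toℕ (next s c) < toℕ c → Back (next s) c →
         ∀ u → Out s (suc (toℕ c)) u → toℕ c ≤ 1 + toℕ u
  back s U q (e , l) = near U (ℕ.m<n⇒m<1+n q , l) (ℕ.≤-reflexive (trans (sym e) (ℕ.+-comm _ 1)))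

-- With one path the distance to the cut is at most 2 by `near-one`. With two, the isolated city is
-- at distance 1, and lowering the cut past it leaves one path, so the bound is 2 + 1 = 3.
near : ∀ (t : Pyramid n) c →
  (∀ u → Out t (toℕ c) u → toℕ c ≤ 3 + toℕ u) ⊎ (∀ u → Out (rev t) (toℕ c) u → toℕ c ≤ 3 + toℕ u)
near {n} t c = go (toℕ c) (Fin.toℕ<n c) (shape t c)
  where
  Near : ℕ → ℕ → Pyramid n → Set
  Near k i s = ∀ u → Out s i u → i ≤ k + toℕ u

  below-one : ∀ i → i < n → AtMostOne (Out t i) → AtMostOne (Out (rev t) i) → Near 2 i t ⊎ Near 2 i (rev t)
  below-one zero    _   _ _  = inj₁ λ _ _ → z≤n
  below-one (suc j) j<n U U′ = subst Goal (Fin.toℕ-fromℕ< (ℕ.<⇒≤ j<n)) step U U′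
    where
    d = fromℕ< (ℕ.<⇒≤ j<n)
    Goal : ℕ → Set
    Goal j = AtMostOne (Out t (suc j)) → AtMostOne (Out (rev t) (suc j)) → Near 2 (suc j) t ⊎ Near 2 (suc j) (rev t)
    step : Goal (toℕ d)
    step U U′ = Sum.map (λ f u o → s≤s (f u o)) (λ f u o → s≤s (f u o))
      (near-one t d (λ e → ℕ.<⇒≢ j<n (trans (cong suc (sym (Fin.toℕ-fromℕ< (ℕ.<⇒≤ j<n)))) e)) U U′)

  lift : ∀ (s : Pyramid n) d → Near 2 (toℕ d) s → Near 3 (suc (toℕ d)) s
  lift s d f u (u≤d , l) = case toℕ u ℕ.≟ toℕ d of λ where
    (yes e) → s≤s (ℕ.≤-trans (ℕ.≤-reflexive (sym e)) (ℕ.m≤n+m _ 2))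
    (no  h) → s≤s (f u (ℕ.≤∧≢⇒< (ℕ.≤-pred u≤d) h , ℕ.<⇒≤ l))

  go : ∀ i → i < n → Shape t i → Near 3 i t ⊎ Near 3 i (rev t)
  go i i<n (one U U′) = Sum.map (λ f u o → ℕ.m≤n⇒m≤1+n (f u o)) (λ f u o → ℕ.m≤n⇒m≤1+n (f u o)) (below-one i i<n U U′)
  go _ i<n (two d refl o o′ V V′) = Sum.map (lift t d) (lift (rev t) d)
    (below-one (toℕ d) (ℕ.<⇒≤ i<n) (two-down t d o′ V) (two-down (rev t) d o V′))

-- In the direction that `near` does not control, at most one lower end is far, since an isolated
-- city is close to the cut. That far end is `v`.
focus : ∀ (t : Pyramid n) c → ∃ λ v → ∀ u → Out t (toℕ c) u ⊎ Out (rev t) (toℕ c) u → toℕ c ≤ 3 + toℕ u ⊎ u ≡ v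
focus {n} t c = case near t c of λ where
    (inj₁ f) → cover t f
    (inj₂ f) → Product.map₂ (λ g u → g u ∘ swap) (cover (rev t) f)
  where
  Far : Pyramid n → Fin n → Set
  Far s u = Out s (toℕ c) u × ¬ toℕ c ≤ 3 + toℕ u

  far-unique : ∀ {s} → Shape s (toℕ c) → AtMostOne (Far s)
  far-unique (one U _) (o , _) (o′ , _) = U o o′
  far-unique (two d e _ _ V _) (o , f) (o′ , f′) = V (o , ≢d f) (o′ , ≢d f′)
    where
    ≢d : ∀ {u} → ¬ toℕ c ≤ 3 + toℕ u → u ≢ d
    ≢d f refl = f (ℕ.≤-trans (ℕ.≤-reflexive (sym e)) (ℕ.+-monoˡ-≤ (toℕ d) (s≤s z≤n)))

  cover : ∀ s → (∀ u → Out s (toℕ c) u → toℕ c ≤ 3 + toℕ u) →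
          ∃ λ v → ∀ u → Out s (toℕ c) u ⊎ Out (rev s) (toℕ c) u → toℕ c ≤ 3 + toℕ u ⊎ u ≡ v
  cover s f = case Fin.any? (λ u → out? (rev s) (toℕ c) u ×-dec ¬? (toℕ c ℕ.≤? 3 + toℕ u)) of λ where
    (yes (v , o)) → v , λ u → [ inj₁ ∘ f u , (λ o′ → case toℕ c ℕ.≤? 3 + toℕ u of λ where
                                                  (yes l) → inj₁ l
                                                  (no h)  → inj₂ (far-unique (shape (rev s) c) (o′ , h) o)) ]′
    -- With no far end the choice of `v` is arbitrary.
    (no ∄) → c , λ u → [ inj₁ ∘ f u , (λ o′ → inj₁ (decidable-stable (toℕ c ℕ.≤? 3 + toℕ u) λ h → ∄ (u , o′ , h))) ]′

-- Encoding a cut by boundedly many bits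

behind : Fin n → ℕ → Fin n
behind c k = fromℕ< (ℕ.≤-<-trans (ℕ.m∸n≤m (toℕ c) k) (Fin.toℕ<n c))

behind-unique : ∀ (c : Fin n) k {u} → k + toℕ u ≡ toℕ c → u ≡ behind c k
behind-unique c k {u} e = Fin.toℕ-injective
  (trans (sym (ℕ.m+n∸m≡n k (toℕ u))) (trans (cong (_∸ k) e) (sym (Fin.toℕ-fromℕ< _))))

site : Fin n → Fin n → Fin 4 → Fin n
site c v 0F = behind c 1
site c v 1F = behind c 2
site c v 2F = behind c 3
site c v 3F = v

Covered : Fin n → Fin n → Pyramid n → Set
Covered c v t = ∀ u → Out t (toℕ c) u ⊎ Out (rev t) (toℕ c) u → ∃ λ k → u ≡ site c v k

covered : ∀ (c : Fin n) t → ∃ λ v → Covered c v t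
covered c t with v , f ← focus t c = v , λ u o → case f u o of λ where
    (inj₁ near) → locate u ([ proj₁ , proj₁ ]′ o) near
    (inj₂ refl) → 3F , refl
  where
  locate : ∀ u {v} → toℕ u < toℕ c → toℕ c ≤ 3 + toℕ u → ∃ λ k → u ≡ site c v k
  locate u 0<d d≤3 with ℕ.m≤n⇒m<n∨m≡n 0<d
  ... | inj₂ e = 0F , behind-unique c 1 e
  ... | inj₁ 1<d with ℕ.m≤n⇒m<n∨m≡n 1<d
  ...   | inj₂ e = 1F , behind-unique c 2 e
  ...   | inj₁ 2<d = 2F , behind-unique c 3 (ℕ.≤-antisym 2<d d≤3)

-- Used in both directions, the first two fields determine the cut before `c`. The last two
-- determine the arcs between `c` and lower cities, which are the low arcs gained by the cut after
-- `c`.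
record Matches (c v : Fin n) (x y : Pyramid n) : Set where
  field
    out  : ∀ k → Out x (toℕ c) (site c v k) → Out y (toℕ c) (site c v k)
    out′ : ∀ k → Out (rev x) (toℕ c) (site c v k) → Out (rev y) (toℕ c) (site c v k)
    nxt  : ∀ k → next x c ≡ site c v k → next y c ≡ site c v k
    prv  : ∀ k → prev x c ≡ site c v k → prev y c ≡ site c v k

Matches-rev : ∀ {c v} {x y : Pyramid n} → Matches c v x y → Matches c v (rev x) (rev y)
Matches-rev m = record { out = out′ ; out′ = out ; nxt = prv ; prv = nxt }
  where open Matches m

Covered-rev : ∀ {c v} {t : Pyramid n} → Covered c v t → Covered c v (rev t)
Covered-rev f u = f u ∘ swap

module _ {c v : Fin n} where
  private i = toℕ c

  -- If the arc of `y` from `u` crossed the cut, `u` would be a site, and the match would make the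
  -- arc of `x` cross as well.
  low-transfer : ∀ {x y : Pyramid n} → Covered c v y → Matches c v y x → ∀ u → Low x i u → Low y i u
  low-transfer {x} {y} cov m u (u<i , l) = u<i , ℕ.≰⇒> λ h → case cov u (inj₁ (u<i , h)) of λ where
    (k , refl) → ℕ.<⇒≱ l (proj₂ (Matches.out m k (u<i , h)))

  next-transfer : ∀ {x y : Pyramid n} → Covered c v x → Matches c v x y → toℕ (next x c) < i → next y c ≡ next x c
  next-transfer {x} cov m l
    with k , e ← cov (next x c) (inj₂ (l , ℕ.≤-reflexive (cong toℕ (sym (prev-next x c)))))
    = trans (Matches.nxt m k e) (sym e)

  next-into : ∀ {x y : Pyramid n} → Covered c v x → Matches c v x y → ∀ {u} → toℕ u < i → next x u ≡ c → next y u ≡ c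
  next-into {x} {y} cov m {u} u<i refl = prev⇒next y (trans
    (next-transfer {rev x} {rev y} (Covered-rev {t = x} cov) (Matches-rev m)
      (subst (λ w → toℕ w < i) (sym (prev-next x u)) u<i)) (prev-next x u))

  same-cut : ∀ {x y : Pyramid n} → Covered c v x → Covered c v y → Matches c v x y → Matches c v y x → SameCut i x y
  same-cut {x} {y} covx covy m m′ =
      (λ u → low-transfer covy m′ u , low-transfer covx m u)
    , (λ u → low-transfer (Covered-rev {t = y} covy) (Matches-rev m′) u
           , low-transfer (Covered-rev {t = x} covx) (Matches-rev m) u)

  -- A low arc gained by moving the cut past `c` joins `c` to a lower city. That city is a site, so
  -- the match makes the arc common to both tours.
  low-suc : ∀ {x y : Pyramid n} → Covered c v x → Matches c v x y → (∀ u → Low x i u → Low y i u)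
          → ∀ u → Low x (suc i) u → Low x i u ⊎ next x u ≡ next y u
  low-suc {x} {y} cov m f u (u≤c , l) with toℕ u ℕ.≟ i | next x u Fin.≟ c
  ... | no u≢c | no h  = inj₁ (ℕ.≤∧≢⇒< (ℕ.≤-pred u≤c) u≢c , ℕ.≤∧≢⇒< (ℕ.≤-pred l) (h ∘ Fin.toℕ-injective))
  ... | no u≢c | yes e = inj₂ (trans e (sym (next-into cov m (ℕ.≤∧≢⇒< (ℕ.≤-pred u≤c) u≢c) e)))
  ... | yes e  | _ with refl ← Fin.toℕ-injective {i = u} {c} e =
    inj₂ (sym (next-transfer cov m (ℕ.≤∧≢⇒< (ℕ.≤-pred l) (next≢ x c ∘ Fin.toℕ-injective))))

  low-suc-transfer : ∀ {x y : Pyramid n} → Covered c v x → Covered c v y → Matches c v x y → Matches c v y x →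
    ∀ u → Low x (suc i) u → Low y (suc i) u
  low-suc-transfer {x} {y} covx covy m m′ u lo@(u≤c , l)
    with low-suc covx m (low-transfer covy m′) u lo
  ... | inj₁ lo′ with q ← proj₂ (low-transfer covy m′ u lo′) = u≤c , ℕ.m<n⇒m<1+n q
  ... | inj₂ e   = u≤c , subst (λ w → toℕ w < suc i) e l

  same-cut-suc : ∀ {x y : Pyramid n} → Covered c v x → Covered c v y → Matches c v x y → Matches c v y x → SameCut (suc i) x y
  same-cut-suc {x} {y} covx covy m m′ =
      (λ u → low-suc-transfer covx covy m m′ u , low-suc-transfer covy covx m′ m u)
    , (λ u → low-suc-transfer cx cy (Matches-rev m) (Matches-rev m′) u
           , low-suc-transfer cy cx (Matches-rev m′) (Matches-rev m) u)
    where
    cx = Covered-rev {t = x} covx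
    cy = Covered-rev {t = y} covy

  -- Only the arcs joining `c` to lower cities are covered neither by `below` nor by `above`, and
  -- `low-suc` shows that they are shared.
  determined : ∀ {x y : Pyramid n} → Covered c v x → Covered c v y → Matches c v x y → Matches c v y x →
    AgreeBelow i x y → AgreeAbove (suc i) x y → next x ≗ next y
  determined {x} {y} covx covy m m′ below above u = case low? x (suc i) u of λ where
    (no ¬lo) → above u ¬lo
    (yes lo) → [ below u , id ]′ (low-suc covx m (low-transfer covy m′) u lo)

flag : ∀ {P : Set} → Dec P → Fin 2
flag (yes _) = 1F
flag (no _)  = 0F

flag-transfer : ∀ {P Q : Set} {p? : Dec P} {q? : Dec Q} → flag p? ≡ flag q? → P → Q
flag-transfer {p? = _}     {yes q} _ _ = q
flag-transfer {p? = yes _} {no _} () _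
flag-transfer {p? = no ¬p} {no _} _ p = contradiction p ¬p

flags : Fin n → Fin n → Pyramid n → Fin 4 → Fin 2
flags c w t 0F = flag (out? t (toℕ c) w)
flags c w t 1F = flag (out? (rev t) (toℕ c) w)
flags c w t 2F = flag (next t c Fin.≟ w)
flags c w t 3F = flag (prev t c Fin.≟ w)

siteCode : Fin n → Fin n → Pyramid n → Fin 4 → Fin (2 ^ 4)
siteCode c v t k = funToFin (flags c (site c v k) t)

-- Four bits at each of four sites give the constant of the upper bound.
profile : Fin n → Fin n → Pyramid n → Fin ((2 ^ 4) ^ 4)
profile c v t = funToFin (siteCode c v t)

funToFin-injective : ∀ {m k} (f g : Fin m → Fin k) → funToFin f ≡ funToFin g → f ≗ g
funToFin-injective f g e i = trans (sym (Fin.finToFun-funToFin f i))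
  (trans (cong (λ c → Fin.finToFun c i) e) (Fin.finToFun-funToFin g i))

profile-matches : ∀ {c v} {x y : Pyramid n} → profile c v x ≡ profile c v y → Matches c v x y
profile-matches {c = c} {v} {x} {y} e = record
  { out  = λ k → flag-transfer (eq k 0F) ; out′ = λ k → flag-transfer (eq k 1F)
  ; nxt  = λ k → flag-transfer (eq k 2F) ; prv  = λ k → flag-transfer (eq k 3F) }
  where
  eq : ∀ k → flags c (site c v k) x ≗ flags c (site c v k) y
  eq k = funToFin-injective _ _ (funToFin-injective (siteCode c v x) (siteCode c v y) e k)

-- The quadratic upper bound

sum : ∀ {A : Set} → (A → ℚ.ℚ) → List A → ℚ.ℚ
sum f xs = foldr ℚ._+_ ℚ.0ℚ (map f xs)

sum-exchange : ∀ {A : Set} {f g h k : A → ℚ.ℚ} → (∀ u → f u ℚ.+ g u ≡ h u ℚ.+ k u) →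
  ∀ xs → sum f xs ℚ.+ sum g xs ≡ sum h xs ℚ.+ sum k xs
sum-exchange e []       = refl
sum-exchange {f = f} {g} {h} {k} e (u ∷ xs) =
  trans (interchange (f u) (sum f xs) (g u) (sum g xs))
 (trans (cong₂ ℚ._+_ (e u) (sum-exchange e xs))
        (interchange (h u) (k u) (sum h xs) (sum k xs)))

glue-value : ∀ {i} (c : Objective n) (x y : Pyramid n) (s : SameCut i x y) (s′ : SameCut i y x) →
  value c (proj₁ (toPSB (glue x y s))) ℚ.+ value c (proj₁ (toPSB (glue y x s′)))
    ≡ value c (proj₁ (toPSB x)) ℚ.+ value c (proj₁ (toPSB y))
glue-value {n} {i} c x y (s , _) s′ = sum-exchange pointwise (allFin n)
  where
  pointwise : ∀ u → c u (glueNext i x y u) ℚ.+ c u (glueNext i y x u) ≡ c u (next x u) ℚ.+ c u (next y u)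
  pointwise u = case low? x i u of λ where
    (yes lo) → cong₂ (λ v w → c u v ℚ.+ c u w) (glueNext-low x y lo) (glueNext-low y x (proj₁ (s u) lo))
    (no ¬lo) → trans (cong₂ (λ v w → c u v ℚ.+ c u w) (glueNext-high x y ¬lo) (glueNext-high y x (¬lo ∘ proj₂ (s u))))
                     (ℚ.+-comm (c u (next y u)) (c u (next x u)))

AdjacentPyramids : Pyramid n → Pyramid n → Set
AdjacentPyramids x y = Adjacent (toPSB x) (toPSB y)

-- If the tours differed on both sides, both glued tours would differ from `x` and `y` and have
-- smaller values, although their values add up to twice the maximum.
adjacent⇒agree : ∀ {i} (x y : Pyramid n) → AdjacentPyramids x y → SameCut i x y →
  ¬ AgreeBelow i x y → AgreeAbove i x y
adjacent⇒agree {i = i} x y (_ , c , vx≡vy , max) same ¬below =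
  decidable-stable (agreeAbove? i x y) λ ¬above →
    let z<x = max (toPSB (glue x y same))
                (λ e → ¬above λ u ¬lo → trans (sym (e u)) (glueNext-high x y ¬lo))
                (λ e → ¬below λ u lo → trans (sym (glueNext-low x y lo)) (e u))
        w<x = max (toPSB (glue y x same′))
                (λ e → ¬below λ u lo → trans (sym (e u)) (glueNext-low y x (proj₁ (proj₁ same u) lo)))
                (λ e → ¬above λ u ¬lo → trans (sym (glueNext-high y x (¬lo ∘ proj₂ (proj₁ same u)))) (e u))
    in ℚ.<-irrefl (trans (glue-value c x y same same′) (cong (value c (proj₁ (toPSB x)) ℚ.+_) (sym vx≡vy)))
         (ℚ.+-mono-< z<x w<x)
  where same′ = SameCut-sym {x = x} {y} same

last-true : ∀ {P : ℕ → Set} → (∀ i → Dec (P i)) → P 0 → ∀ n → ¬ P n → ∃ λ i → i < n × P i × ¬ P (suc i)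
last-true P? p zero    ¬p = contradiction p ¬p
last-true P? p (suc n) ¬p with P? n
... | yes q = n , ℕ.n<1+n n , q , ¬p
... | no ¬q with i , i<n , r ← last-true P? p n ¬q = i , ℕ.m<n⇒m<1+n i<n , r

module _ {n m : ℕ} (t : Fin (2 + m) → Pyramid n)
         (adjacent : ∀ k l → k ≢ l → AdjacentPyramids (t k) (t l)) where

  LeftFixed : Fin (2 + m) → ℕ → Set
  LeftFixed k i = ∀ l → SameCut i (t k) (t l) → AgreeBelow i (t k) (t l)

  leftFixed? : ∀ k i → Dec (LeftFixed k i)
  leftFixed? k i = Fin.all? λ l → sameCut? i (t k) (t l) →-dec agreeBelow? i (t k) (t l)

  leftFixed-0 : ∀ k → LeftFixed k 0
  leftFixed-0 k l _ u (() , _)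

  -- At the cut n every arc is low and all cuts coincide, so the tour would equal another member `l`
  -- of the clique.
  ¬leftFixed-n : ∀ k → ¬ LeftFixed k n
  ¬leftFixed-n k fixed = proj₁ (adjacent k l (≢-sym (Fin.punchInᵢ≢i k 0F)))
      λ u → fixed l (all-low (t k) (t l) , all-low (rev (t k)) (rev (t l))) u (Fin.toℕ<n u , Fin.toℕ<n _)
    where
    l = Fin.punchIn k 0F
    all-low : ∀ x y → LowEquiv n x y
    all-low x y u = (λ _ → Fin.toℕ<n u , Fin.toℕ<n _) , (λ _ → Fin.toℕ<n u , Fin.toℕ<n _)

  -- Some `j` with the same cut differs from `k` below. If `l` differs from `k` below, adjacency
  -- settles the claim. Otherwise `l` also differs from `j` below, and both `k` and `l` agree with
  -- `j` above.
  rightFixed : ∀ {k i} → ¬ LeftFixed k i → ∀ l → SameCut i (t k) (t l) → AgreeAbove i (t k) (t l)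
  rightFixed {k} {i} ¬fixed l kl
    with j , ¬impl ← Fin.¬∀⟶∃¬ _ _ (λ l → sameCut? i (t k) (t l) →-dec agreeBelow? i (t k) (t l)) ¬fixed
    with agreeBelow? i (t k) (t l)
  ... | no ¬b = adjacent⇒agree (t k) (t l) (adjacent k l λ { refl → ¬b λ _ _ → refl }) kl ¬b
  ... | yes b = λ u ¬lo → trans (agree k kj ¬kj u ¬lo) (sym (agree l lj ¬lj u (¬lo ∘ proj₂ (proj₁ kl u))))
    where
    kj : SameCut i (t k) (t j)
    kj = decidable-stable (sameCut? i (t k) (t j)) λ h → ¬impl (⊥-elim ∘ h)
    ¬kj : ¬ AgreeBelow i (t k) (t j)
    ¬kj h = ¬impl λ _ → h
    lj : SameCut i (t l) (t j)
    lj = SameCut-trans {x = t l} {t k} {t j} (SameCut-sym {x = t k} {t l} kl) kj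
    ¬lj : ¬ AgreeBelow i (t l) (t j)
    ¬lj h = ¬kj λ u lo → trans (b u lo) (h u (proj₁ (proj₁ kl u) lo))
    agree : ∀ k → SameCut i (t k) (t j) → ¬ AgreeBelow i (t k) (t j) → AgreeAbove i (t k) (t j)
    agree k s ¬b = adjacent⇒agree (t k) (t j) (adjacent k j λ { refl → ¬b λ _ _ → refl }) s ¬b

  pivot : ∀ k → ∃ λ i → i < n × LeftFixed k i × ¬ LeftFixed k (suc i)
  pivot k = last-true (leftFixed? k) (leftFixed-0 k) n (¬leftFixed-n k)

  pivotCity : Fin (2 + m) → Fin n
  pivotCity k = fromℕ< (proj₁ (proj₂ (pivot k)))

  pivot-left : ∀ k → LeftFixed k (toℕ (pivotCity k))
  pivot-left k = subst (LeftFixed k) (sym (Fin.toℕ-fromℕ< _)) (proj₁ (proj₂ (proj₂ (pivot k))))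

  pivot-right : ∀ k → ¬ LeftFixed k (suc (toℕ (pivotCity k)))
  pivot-right k = subst (λ i → ¬ LeftFixed k (suc i)) (sym (Fin.toℕ-fromℕ< _)) (proj₂ (proj₂ (proj₂ (pivot k))))

  focusCity : Fin (2 + m) → Fin n
  focusCity k = proj₁ (covered (pivotCity k) (t k))

  focus-covers : ∀ k → Covered (pivotCity k) (focusCity k) (t k)
  focus-covers k = proj₂ (covered (pivotCity k) (t k))

  code : Fin (2 + m) → Fin (n * (n * (2 ^ 4) ^ 4))
  code k = combine (pivotCity k) (combine (focusCity k) (profile (pivotCity k) (focusCity k) (t k)))

  -- Equal codes mean a common pivot and equal cuts before and after it. The first cut gives
  -- agreement below, the second agreement above through `rightFixed`.
  code-injective : ∀ {k l} → code k ≡ code l → next (t k) ≗ next (t l)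
  code-injective {k} {l} e = determined covk covl mkl mlk
      (pivot-left k l (same-cut covk covl mkl mlk))
      (rightFixed (pivot-right k) l (same-cut-suc covk covl mkl mlk))
    where
    c = pivotCity k
    v = focusCity k
    e₁ = Fin.combine-injective c (combine v (profile c v (t k))) (pivotCity l) _ e
    e₂ = Fin.combine-injective v (profile c v (t k)) (focusCity l) _ (proj₂ e₁)
    covk : Covered c v (t k)
    covk = focus-covers k
    covl : Covered c v (t l)
    covl = subst₂ (λ c v → Covered c v (t l)) (sym (proj₁ e₁)) (sym (proj₁ e₂)) (focus-covers l)
    same : profile c v (t k) ≡ profile c v (t l)
    same = trans (proj₂ e₂) (sym (cong₂ (λ c v → profile c v (t l)) (proj₁ e₁) (proj₁ e₂)))
    mkl : Matches c v (t k) (t l)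
    mkl = profile-matches same
    mlk : Matches c v (t l) (t k)
    mlk = profile-matches (sym same)

  clique-size : 2 + m ≤ n * (n * (2 ^ 4) ^ 4)
  clique-size = ℕ.≮⇒≥ λ big → case Fin.pigeonhole big code of λ where
    (k , l , k<l , e) → proj₁ (adjacent k l (λ { refl → ℕ.<-irrefl refl k<l })) (code-injective e)

regroup : ∀ n k → n * (n * k) ≡ k * n ^ 2
regroup n k = trans (sym (ℕ.*-assoc n n k)) (trans (ℕ.*-comm (n * n) k) (cong (λ l → k * (n * l)) (sym (ℕ.*-identityʳ n))))

clique-upper : ∀ n m → Clique (2 + n) m → m ≤ (2 ^ 4) ^ 4 * (2 + n) ^ 2
clique-upper n 0 _ = z≤n
-- The pivot argument compares two members, so a single tour is bounded by the positivity of both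
-- factors.
clique-upper n 1 _ = ℕ.*-mono-≤ (ℕ.m^n>0 (2 ^ 4) 4) (ℕ.m^n>0 (2 + n) 2)
clique-upper n (suc (suc m)) (f , adjacent) = ℕ.≤-trans
  (clique-size (fromPSB ∘ f) adjacent) (ℕ.≤-reflexive (regroup (2 + n) ((2 ^ 4) ^ 4)))

-- A clique of quadratic size

sum-cong : ∀ {A : Set} {f g : A → ℚ.ℚ} → (∀ u → f u ≡ g u) → ∀ xs → sum f xs ≡ sum g xs
sum-cong e []       = refl
sum-cong e (u ∷ xs) = cong₂ ℚ._+_ (e u) (sum-cong e xs)

sum-≤ : ∀ {A : Set} {f g : A → ℚ.ℚ} → (∀ u → f u ℚ.≤ g u) → ∀ xs → sum f xs ℚ.≤ sum g xs
sum-≤ l []       = ℚ.≤-refl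
sum-≤ l (u ∷ xs) = ℚ.+-mono-≤ (l u) (sum-≤ l xs)

sum-< : ∀ {A : Set} {f g : A → ℚ.ℚ} → (∀ u → f u ℚ.≤ g u) → ∀ {u xs} → u ∈ xs → f u ℚ.< g u → sum f xs ℚ.< sum g xs
sum-< l {xs = _ ∷ xs} (here refl) s = ℚ.+-mono-<-≤ s (sum-≤ l xs)
sum-< l {xs = u ∷ _}  (there i)   s = ℚ.+-mono-≤-< (l u) (sum-< l i s)

succ-injective : (t : Tour n) → Injective (succ t)
succ-injective t {u} {v} e = trans (sym (pred-succ t u)) (trans (cong (pred t) e) (pred-succ t v))

Between : Pyramid n → Pyramid n → (Fin n → Fin n) → Set
Between x y f = ∀ u → f u ≡ next x u ⊎ f u ≡ next y u

-- The objective is the indicator of the arcs of `x` and `y`. Any other tour is injective, so by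
-- hypothesis it uses some other arc and loses there.
adjacent-if : ∀ (x y : Pyramid n) → ¬ next x ≗ next y →
  (∀ {f} → Injective f → Between x y f → f ≗ next x ⊎ f ≗ next y) → AdjacentPyramids x y
adjacent-if {n} x y x≢y only = x≢y , c , sum-cong (λ u → trans (on-x u) (sym (on-y u))) (allFin n) , strict
  where
  arc? : ∀ u v → Dec (v ≡ next x u ⊎ v ≡ next y u)
  arc? u v = (v Fin.≟ next x u) ⊎-dec (v Fin.≟ next y u)

  c : Objective n
  c u v = choose (arc? u v) ℚ.1ℚ ℚ.0ℚ

  on-x : ∀ u → c u (next x u) ≡ ℚ.1ℚ
  on-x u = choose-yes (arc? u _) (inj₁ refl)

  on-y : ∀ u → c u (next y u) ≡ ℚ.1ℚ
  on-y u = choose-yes (arc? u _) (inj₂ refl)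

  0<1 : ℚ.0ℚ ℚ.< ℚ.1ℚ
  0<1 = toWitness {a? = ℚ.0ℚ ℚ.<? ℚ.1ℚ} _

  c≤ : ∀ u v → c u v ℚ.≤ c u (next x u)
  c≤ u v = subst (c u v ℚ.≤_) (sym (on-x u)) (≤1 (arc? u v))
    where
    ≤1 : ∀ {P : Set} (p? : Dec P) → choose p? ℚ.1ℚ ℚ.0ℚ ℚ.≤ ℚ.1ℚ
    ≤1 (yes _) = ℚ.≤-refl
    ≤1 (no _)  = ℚ.<⇒≤ 0<1

  strict : ∀ z → ¬ SameTour (proj₁ z) (proj₁ (toPSB x)) → ¬ SameTour (proj₁ z) (proj₁ (toPSB y)) →
           value c (proj₁ z) ℚ.< value c (proj₁ (toPSB x))
  strict (z , _) z≢x z≢y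
    with u , ¬arc ← Fin.¬∀⟶∃¬ n _ (λ u → arc? u (succ z u))
           (λ b → [ z≢x , z≢y ]′ (only (succ-injective z) b))
    = sum-< (λ u → c≤ u (succ z u)) (∈-allFin u)
        (subst₂ ℚ._<_ (sym (choose-no (arc? u _) ¬arc)) (sym (on-x u)) 0<1)

-- Tours with two stops on the way down

infixl 9 _[_↦_]
abstract
  -- Opaque, so that nested updates are evaluated only through `hit` and `miss`; the outermost
  -- update wins.
  _[_↦_] : (ℕ → ℕ) → ℕ → ℕ → ℕ → ℕ
  (f [ k ↦ v ]) u = choose (u ℕ.≟ k) v (f u)

  hit : ∀ f k v → (f [ k ↦ v ]) k ≡ v
  hit f k v = choose-yes (k ℕ.≟ k) refl

  miss : ∀ f {k v u w} → u ≢ k → f u ≡ w → (f [ k ↦ v ]) u ≡ w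
  miss f u≢k e = trans (choose-no (_ ℕ.≟ _) u≢k) e

-- The tour that descends along e, b + 1, a + 1, 0 and visits all other cities on the way up.
module _ (a b e : ℕ) where
  private
    f₁ = suc [ a ↦ 2 + a ]
    f₂ = f₁  [ b ↦ 2 + b ]
    f₃ = f₂  [ 1 + b ↦ 1 + a ]
    f₄ = f₃  [ 1 + a ↦ 0 ]
    g₁ = ℕ.pred [ 2 + a ↦ a ]
    g₂ = g₁  [ 2 + b ↦ b ]
    g₃ = g₂  [ 1 + b ↦ e ]
    g₄ = g₃  [ 1 + a ↦ 1 + b ]

  up down : ℕ → ℕ
  up   = f₄ [ e ↦ 1 + b ]
  down = g₄ [ 0 ↦ 1 + a ]

  record Ordinary (u : ℕ) : Set where
    constructor ordinary
    field
      ≢a : u ≢ a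
      ≢1+a : u ≢ 1 + a
      ≢b : u ≢ b
      ≢1+b : u ≢ 1 + b
      ≢e : u ≢ e

  up-ordinary : ∀ {u} → Ordinary u → up u ≡ suc u
  up-ordinary (ordinary p q r s t) = miss f₄ t (miss f₃ q (miss f₂ s (miss f₁ r (miss suc p refl))))

  up-e : up e ≡ 1 + b
  up-e = hit f₄ e _

  down-0 : down 0 ≡ 1 + a
  down-0 = hit g₄ 0 _

  down-1+a : down (1 + a) ≡ 1 + b
  down-1+a = miss g₄ (λ ()) (hit g₃ (1 + a) _)

  down-ordinary : ∀ {u} → u ≢ a → u ≢ b → u ≢ 1 + a → u ≢ 1 + b → down (suc u) ≡ u
  down-ordinary p q r s = miss g₄ (λ ()) (miss g₃ (p ∘ ℕ.suc-injective) (miss g₂ (q ∘ ℕ.suc-injective)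
    (miss g₁ (s ∘ ℕ.suc-injective) (miss ℕ.pred (r ∘ ℕ.suc-injective) refl))))

  module _ (1+a<b : 1 + a < b) (1+b<e : 1 + b < e) where
    private
      a<b   = ℕ.<-trans (ℕ.n<1+n a) 1+a<b
      b<e   = ℕ.<-trans (ℕ.n<1+n b) 1+b<e
      1+a<e = ℕ.<-trans 1+a<b b<e
      a<e   = ℕ.<-trans a<b b<e

    up-1+a : up (1 + a) ≡ 0
    up-1+a = miss f₄ (ℕ.<⇒≢ 1+a<e) (hit f₃ (1 + a) _)

    up-1+b : up (1 + b) ≡ 1 + a
    up-1+b = miss f₄ (ℕ.<⇒≢ 1+b<e) (miss f₃ (ℕ.>⇒≢ (s≤s a<b)) (hit f₂ (1 + b) _))

    up-b : up b ≡ 2 + b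
    up-b = miss f₄ (ℕ.<⇒≢ b<e) (miss f₃ (ℕ.>⇒≢ 1+a<b) (miss f₂ (ℕ.<⇒≢ (ℕ.n<1+n b)) (hit f₁ b _)))

    up-a : up a ≡ 2 + a
    up-a = miss f₄ (ℕ.<⇒≢ a<e) (miss f₃ (ℕ.<⇒≢ (ℕ.n<1+n a)) (miss f₂ (ℕ.<⇒≢ (ℕ.m<n⇒m<1+n a<b))
             (miss f₁ (ℕ.<⇒≢ a<b) (hit suc a _))))

    down-1+b : down (1 + b) ≡ e
    down-1+b = miss g₄ (λ ()) (miss g₃ (ℕ.>⇒≢ (s≤s a<b)) (hit g₂ (1 + b) _))

    down-2+b : down (2 + b) ≡ b
    down-2+b = miss g₄ (λ ()) (miss g₃ (ℕ.>⇒≢ (s≤s (ℕ.m<n⇒m<1+n a<b))) (miss g₂ (ℕ.>⇒≢ (ℕ.n<1+n _)) (hit g₁ (2 + b) _)))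

    down-2+a : down (2 + a) ≡ a
    down-2+a = miss g₄ (λ ()) (miss g₃ (ℕ.>⇒≢ (ℕ.n<1+n _)) (miss g₂ (ℕ.<⇒≢ (s≤s 1+a<b))
      (miss g₁ (ℕ.<⇒≢ (s≤s (s≤s a<b))) (hit ℕ.pred (2 + a) _))))

    data Role : ℕ → Set where
      is-a    : Role a
      is-1+a  : Role (1 + a)
      is-b    : Role b
      is-1+b  : Role (1 + b)
      is-e    : Role e
      is-else : ∀ {u} → Ordinary u → Role u

    role : ∀ u → Role u
    role u with u ℕ.≟ a | u ℕ.≟ 1 + a | u ℕ.≟ b | u ℕ.≟ 1 + b | u ℕ.≟ e
    ... | yes refl | _ | _ | _ | _ = is-a
    ... | no _ | yes refl | _ | _ | _ = is-1+a
    ... | no _ | no _ | yes refl | _ | _ = is-b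
    ... | no _ | no _ | no _ | yes refl | _ = is-1+b
    ... | no _ | no _ | no _ | no _ | yes refl = is-e
    ... | no p | no q | no r | no s | no t = is-else (ordinary p q r s t)

    down-up : ∀ u → down (up u) ≡ u
    down-up u with role u
    ... | is-a      = trans (cong down up-a) down-2+a
    ... | is-1+a    = trans (cong down up-1+a) down-0
    ... | is-b      = trans (cong down up-b) down-2+b
    ... | is-1+b    = trans (cong down up-1+b) down-1+a
    ... | is-e      = trans (cong down up-e) down-1+b
    ... | is-else o = trans (cong down (up-ordinary o)) (down-ordinary ≢a ≢b ≢1+a ≢1+b)
      where open Ordinary o

    up-bound : ∀ {u} → u ≤ e → up u ≤ e
    up-bound {u} u≤e with role u
    ... | is-a      = subst (_≤ e) (sym up-a) 1+a<e
    ... | is-1+a    = subst (_≤ e) (sym up-1+a) z≤n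
    ... | is-b      = subst (_≤ e) (sym up-b) 1+b<e
    ... | is-1+b    = subst (_≤ e) (sym up-1+b) (ℕ.<⇒≤ 1+a<e)
    ... | is-e      = subst (_≤ e) (sym up-e) (ℕ.<⇒≤ 1+b<e)
    ... | is-else o = subst (_≤ e) (sym (up-ordinary o)) (ℕ.≤∧≢⇒< u≤e (Ordinary.≢e o))

    up-down : ∀ {v} → v ≤ e → up (down v) ≡ v × down v ≤ e
    up-down {zero}  _ = trans (cong up down-0) up-1+a , subst (_≤ e) (sym down-0) (ℕ.<⇒≤ 1+a<e)
    up-down {suc u} u<e with role u
    ... | is-a      = trans (cong up down-1+a) up-1+b , subst (_≤ e) (sym down-1+a) (ℕ.<⇒≤ 1+b<e)
    ... | is-1+a    = trans (cong up down-2+a) up-a , subst (_≤ e) (sym down-2+a) (ℕ.<⇒≤ a<e)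
    ... | is-b      = trans (cong up down-1+b) up-e , subst (_≤ e) (sym down-1+b) ℕ.≤-refl
    ... | is-1+b    = trans (cong up down-2+b) up-b , subst (_≤ e) (sym down-2+b) (ℕ.<⇒≤ b<e)
    ... | is-e      = contradiction u<e (ℕ.<-irrefl refl)
    ... | is-else o = trans (cong up d) (up-ordinary o) , subst (_≤ e) (sym d) (ℕ.<⇒≤ u<e)
      where
      open Ordinary o
      d = down-ordinary ≢a ≢b ≢1+a ≢1+b

    -- Cities on the way up have a larger successor, the stops `1 + a` and `1 + b` a larger
    -- predecessor. So these tours have no step-back peaks.
    no-peak : ∀ {u} → u ≢ e → down u < u → ¬ up u < u
    no-peak {u} u≢e p q with role u
    ... | is-a      = ℕ.<-asym q (subst (a <_) (sym up-a) (ℕ.m<n⇒m<1+n (ℕ.n<1+n a)))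
    ... | is-1+a    = ℕ.<-asym p (subst (1 + a <_) (sym down-1+a) (s≤s a<b))
    ... | is-b      = ℕ.<-asym q (subst (b <_) (sym up-b) (ℕ.m<n⇒m<1+n (ℕ.n<1+n b)))
    ... | is-1+b    = ℕ.<-asym p (subst (1 + b <_) (sym down-1+b) 1+b<e)
    ... | is-e      = u≢e refl
    ... | is-else o = ℕ.<-asym q (subst (u <_) (sym (up-ordinary o)) (ℕ.n<1+n u))

    up≢ : ∀ u → up u ≢ u
    up≢ u h with role u
    ... | is-a      = ℕ.>⇒≢ (ℕ.m<n⇒m<1+n (ℕ.n<1+n a)) (trans (sym up-a) h)
    ... | is-1+a    = ℕ.0≢1+n (trans (sym up-1+a) h)
    ... | is-b      = ℕ.>⇒≢ (ℕ.m<n⇒m<1+n (ℕ.n<1+n b)) (trans (sym up-b) h)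
    ... | is-1+b    = ℕ.<⇒≢ (s≤s a<b) (trans (sym up-1+b) h)
    ... | is-e      = ℕ.<⇒≢ 1+b<e (trans (sym up-e) h)
    ... | is-else o = ℕ.1+n≢n (trans (sym (up-ordinary o)) h)

    bounded : ∀ {k} → k ≤ e → Fin (suc e)
    bounded k≤e = fromℕ< (s≤s k≤e)

    small : (u : Fin (suc e)) → toℕ u ≤ e
    small u = ℕ.≤-pred (Fin.toℕ<n u)

    detour : Pyramid (suc e)
    detour = record
      { next = nx ; prev = pv
      ; next-prev = λ v → Fin.toℕ-injective (trans (toℕ-nx (pv v)) (trans (cong up (toℕ-pv v)) (proj₁ (up-down (small v)))))
      ; prev-next = λ u → Fin.toℕ-injective (trans (toℕ-pv (nx u)) (trans (cong down (toℕ-nx u)) (down-up (toℕ u))))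
      ; next≢ = λ u h → up≢ (toℕ u) (trans (sym (toℕ-nx u)) (cong toℕ h))
      ; peaks = λ u u≢e p q → contradiction (subst (_< toℕ u) (toℕ-nx u) q)
                  (no-peak (u≢e ∘ cong suc) (subst (_< toℕ u) (toℕ-pv u) p)) }
      where
      nx pv : Fin (suc e) → Fin (suc e)
      nx u = bounded (up-bound (small u))
      pv v = bounded (proj₂ (up-down (small v)))
      toℕ-nx : ∀ u → toℕ (nx u) ≡ up (toℕ u)
      toℕ-nx u = Fin.toℕ-fromℕ< _
      toℕ-pv : ∀ u → toℕ (pv u) ≡ down (toℕ u)
      toℕ-pv u = Fin.toℕ-fromℕ< _

    toℕ-next : ∀ u → toℕ (next detour u) ≡ up (toℕ u)
    toℕ-next u = Fin.toℕ-fromℕ< _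

-- Adjacency of two such tours

Apart : ℕ → ℕ → Set
Apart a c = a ≢ c × a ≢ 1 + c × 1 + a ≢ c

Apart-sym : ∀ {a c} → Apart a c → Apart c a
Apart-sym (p , q , r) = ≢-sym p , ≢-sym r , ≢-sym q

module _ {a b c d e : ℕ} (1+a<b : 1 + a < b) (1+b<e : 1 + b < e) (1+c<d : 1 + c < d) (1+d<e : 1 + d < e)
         (1+a<d : 1 + a < d) (1+c<b : 1 + c < b)
         {f : Fin (suc e) → Fin (suc e)} (f-injective : Injective f)
         (between : ∀ u → toℕ (f u) ≡ up a b e (toℕ u) ⊎ toℕ (f u) ≡ up c d e (toℕ u)) where

  private
    b<e   = ℕ.<-trans (ℕ.n<1+n b) 1+b<e
    d<e   = ℕ.<-trans (ℕ.n<1+n d) 1+d<e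
    a<b   = ℕ.<-trans (ℕ.n<1+n a) 1+a<b
    a<d   = ℕ.<-trans (ℕ.n<1+n a) 1+a<d
    c<b   = ℕ.<-trans (ℕ.n<1+n c) 1+c<b
    1+a<e = ℕ.<-trans 1+a<b b<e
    1+c<e = ℕ.<-trans 1+c<d d<e
    a<e   = ℕ.<-trans a<b b<e
    c<e   = ℕ.<-trans c<b b<e

  Follows : ℕ → Set
  Follows k = ∀ u → toℕ u ≡ k → toℕ (f u) ≡ up a b e k

  -- If the second tour enters the successor of k from l, then f, taking the arc from k, cannot do so.
  chain : ∀ {k l w} → k ≤ e → up a b e k ≡ w → up c d e l ≡ w → Follows k → Follows l
  chain {k} {l} k≤e p q fk u refl with between u
  ... | inj₁ h = h
  ... | inj₂ h = trans (cong (toℕ ∘ f) (sym k≡u)) (trans (fk k′ k′≡k) (cong (up a b e) (trans (sym k′≡k) (cong toℕ k≡u))))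
    where
    k′ : Fin (suc e)
    k′ = fromℕ< (s≤s k≤e)
    k′≡k : toℕ k′ ≡ k
    k′≡k = Fin.toℕ-fromℕ< _
    k≡u : k′ ≡ u
    k≡u = f-injective (Fin.toℕ-injective (trans (fk k′ k′≡k) (trans p (sym (trans h q)))))

  common : ∀ {k w} → up a b e k ≡ w → up c d e k ≡ w → Follows k
  common p q u refl = [ id , (λ h → trans h (trans q (sym p))) ]′ (between u)

  private
    ord-a : Apart a c → Ordinary c d e a
    ord-a (p , q , _) = ordinary p q (ℕ.<⇒≢ a<d) (ℕ.<⇒≢ (ℕ.m<n⇒m<1+n a<d)) (ℕ.<⇒≢ a<e)
    ord-1+a : Apart a c → Ordinary c d e (1 + a)
    ord-1+a (p , _ , r) = ordinary r (p ∘ ℕ.suc-injective) (ℕ.<⇒≢ 1+a<d) (ℕ.<⇒≢ (s≤s a<d)) (ℕ.<⇒≢ 1+a<e)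
    ord-b : Apart b d → Ordinary c d e b
    ord-b (p , q , _) = ordinary (ℕ.>⇒≢ c<b) (ℕ.>⇒≢ 1+c<b) p q (ℕ.<⇒≢ b<e)
    ord-1+b : Apart b d → Ordinary c d e (1 + b)
    ord-1+b (p , _ , r) = ordinary (ℕ.>⇒≢ (ℕ.m<n⇒m<1+n c<b)) (ℕ.>⇒≢ (s≤s c<b)) r (p ∘ ℕ.suc-injective) (ℕ.<⇒≢ 1+b<e)
    ord-c : Apart a c → Ordinary a b e c
    ord-c (p , q , r) = ordinary (≢-sym p) (≢-sym r) (ℕ.<⇒≢ c<b) (ℕ.<⇒≢ (ℕ.m<n⇒m<1+n c<b)) (ℕ.<⇒≢ c<e)
    ord-1+c : Apart a c → Ordinary a b e (1 + c)
    ord-1+c (p , q , r) = ordinary (≢-sym q) (≢-sym p ∘ ℕ.suc-injective) (ℕ.<⇒≢ 1+c<b) (ℕ.<⇒≢ (s≤s c<b)) (ℕ.<⇒≢ 1+c<e)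
    ord-1+d : Apart b d → Ordinary a b e (1 + d)
    ord-1+d (p , q , r) = ordinary (ℕ.>⇒≢ (ℕ.m<n⇒m<1+n a<d)) (ℕ.>⇒≢ (s≤s a<d)) (≢-sym q) (≢-sym p ∘ ℕ.suc-injective) (ℕ.<⇒≢ 1+d<e)

    -- In the generic case the forced choices run through e, b, b + 1, a, a + 1, c + 1, c, d + 1, d,
    -- the nontrivial cycle. Each lemma down to `follow-d` is one link: the first tour enters from
    -- its start the city that the second enters from its end. For a = c, `follow-1+d′` leads from b
    -- + 1 directly to d + 1.
    follow-b : Apart b d → Follows e → Follows b
    follow-b A = chain ℕ.≤-refl (up-e a b e) (up-ordinary c d e (ord-b A))

    follow-1+b : Apart b d → Follows b → Follows (1 + b)
    follow-1+b A = chain (ℕ.<⇒≤ b<e) (up-b a b e 1+a<b 1+b<e) (up-ordinary c d e (ord-1+b A))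

    follow-a : Apart a c → Follows (1 + b) → Follows a
    follow-a A = chain (ℕ.<⇒≤ 1+b<e) (up-1+b a b e 1+a<b 1+b<e) (up-ordinary c d e (ord-a A))

    follow-1+a : Apart a c → Follows a → Follows (1 + a)
    follow-1+a A = chain (ℕ.<⇒≤ a<e) (up-a a b e 1+a<b 1+b<e) (up-ordinary c d e (ord-1+a A))

    follow-1+c : Follows (1 + a) → Follows (1 + c)
    follow-1+c = chain (ℕ.<⇒≤ 1+a<e) (up-1+a a b e 1+a<b 1+b<e) (up-1+a c d e 1+c<d 1+d<e)

    follow-c : Apart a c → Follows (1 + c) → Follows c
    follow-c A = chain (ℕ.<⇒≤ 1+c<e) (up-ordinary a b e (ord-1+c A)) (up-a c d e 1+c<d 1+d<e)

    follow-1+d : Apart a c → Follows c → Follows (1 + d)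
    follow-1+d A = chain (ℕ.<⇒≤ c<e) (up-ordinary a b e (ord-c A)) (up-1+b c d e 1+c<d 1+d<e)

    follow-1+d′ : a ≡ c → Follows (1 + b) → Follows (1 + d)
    follow-1+d′ refl = chain (ℕ.<⇒≤ 1+b<e) (up-1+b a b e 1+a<b 1+b<e) (up-1+b c d e 1+c<d 1+d<e)

    follow-d : Apart b d → Follows (1 + d) → Follows d
    follow-d A = chain (ℕ.<⇒≤ 1+d<e) (up-ordinary a b e (ord-1+d A)) (up-b c d e 1+c<d 1+d<e)

  module _ (Fa : Follows a) (F1+a : Follows (1 + a)) (Fb : Follows b) (F1+b : Follows (1 + b)) (Fe : Follows e)
           (Fc : Follows c) (F1+c : Follows (1 + c)) (Fd : Follows d) (F1+d : Follows (1 + d)) where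

    follow-all : ∀ k → Follows k
    follow-all k with role a b e 1+a<b 1+b<e k | role c d e 1+c<d 1+d<e k
    ... | is-a      | _         = Fa
    ... | is-1+a    | _         = F1+a
    ... | is-b      | _         = Fb
    ... | is-1+b    | _         = F1+b
    ... | is-e      | _         = Fe
    ... | is-else _ | is-a      = Fc
    ... | is-else _ | is-1+a    = F1+c
    ... | is-else _ | is-b      = Fd
    ... | is-else _ | is-1+b    = F1+d
    ... | is-else _ | is-e      = Fe
    ... | is-else o | is-else p = common (up-ordinary a b e o) (up-ordinary c d e p)

  -- For b = d the arcs from `e` and `b` are common, and the cycle shrinks to b + 1, a, a + 1, c +
  -- 1, c.
  follow-from-1+b : Apart a c → b ≡ d → Follows (1 + b) → ∀ k → Follows k
  follow-from-1+b A refl F1+b = follow-all Fa F1+a Fb F1+b (common (up-e a b e) (up-e c d e)) Fc F1+c Fb F1+b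
    where
    Fa   = follow-a A F1+b
    F1+a = follow-1+a A Fa
    F1+c = follow-1+c F1+a
    Fc   = follow-c A F1+c
    Fb   = common (up-b a b e 1+a<b 1+b<e) (up-b c d e 1+c<d 1+d<e)

  follow-from-e : a ≡ c ⊎ Apart a c → Apart b d → Follows e → ∀ k → Follows k
  follow-from-e (inj₁ refl) B Fe = follow-all Fa F1+a Fb F1+b Fe Fa F1+a Fd F1+d
    where
    Fb   = follow-b B Fe
    F1+b = follow-1+b B Fb
    Fa   = common (up-a a b e 1+a<b 1+b<e) (up-a c d e 1+c<d 1+d<e)
    F1+a = common (up-1+a a b e 1+a<b 1+b<e) (up-1+a c d e 1+c<d 1+d<e)
    F1+d = follow-1+d′ refl F1+b
    Fd   = follow-d B F1+d
  follow-from-e (inj₂ A) B Fe = follow-all Fa F1+a Fb F1+b Fe Fc F1+c Fd F1+d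
    where
    Fb   = follow-b B Fe
    F1+b = follow-1+b B Fb
    Fa   = follow-a A F1+b
    F1+a = follow-1+a A Fa
    F1+c = follow-1+c F1+a
    Fc   = follow-c A F1+c
    F1+d = follow-1+d A Fc
    Fd   = follow-d B F1+d

module _ {a b c d e : ℕ} (1+a<b : 1 + a < b) (1+b<e : 1 + b < e) (1+c<d : 1 + c < d) (1+d<e : 1 + d < e)
         (1+a<d : 1 + a < d) (1+c<b : 1 + c < b) where
  private
    x = detour a b e 1+a<b 1+b<e
    y = detour c d e 1+c<d 1+d<e

  -- The choice of `f` at one city of the cycle, `e` or `1 + b`, forces all others. Exchanging the
  -- roles of the tours treats the other choice.
  detours-adjacent : (a ≡ c ⊎ Apart a c) × Apart b d ⊎ Apart a c × b ≡ d → AdjacentPyramids x y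
  detours-adjacent apart = adjacent-if x y (distinct apart) (λ inj btw → only inj btw apart)
    where
    city : ∀ {k} → k ≤ e → ∃ λ (u : Fin (suc e)) → toℕ u ≡ k
    city k≤e = fromℕ< (s≤s k≤e) , Fin.toℕ-fromℕ< _

    at : ∀ {k u} → toℕ u ≡ k → next x u ≡ next y u → up a b e k ≡ up c d e k
    at {u = u} refl h = trans (sym (toℕ-next a b e 1+a<b 1+b<e u)) (trans (cong toℕ h) (toℕ-next c d e 1+c<d 1+d<e u))

    distinct : (a ≡ c ⊎ Apart a c) × Apart b d ⊎ Apart a c × b ≡ d → ¬ next x ≗ next y
    distinct (inj₁ (_ , b≢d , _)) h with u , u≡e ← city ℕ.≤-refl =
      b≢d (ℕ.suc-injective (trans (sym (up-e a b e)) (trans (at u≡e (h u)) (up-e c d e))))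
    distinct (inj₂ ((a≢c , _) , refl)) h with u , u≡1+b ← city (ℕ.<⇒≤ 1+b<e) =
      a≢c (ℕ.suc-injective (trans (sym (up-1+b a b e 1+a<b 1+b<e)) (trans (at u≡1+b (h u)) (up-1+b c d e 1+c<d 1+d<e))))

    only : ∀ {f} → Injective f → Between x y f →
           (a ≡ c ⊎ Apart a c) × Apart b d ⊎ Apart a c × b ≡ d → f ≗ next x ⊎ f ≗ next y
    only {f} inj btw = λ where
        (inj₁ (A , B)) → decide ℕ.≤-refl
          (follow-from-e 1+a<b 1+b<e 1+c<d 1+d<e 1+a<d 1+c<b inj β A B)
          (follow-from-e 1+c<d 1+d<e 1+a<b 1+b<e 1+c<b 1+a<d inj (swap ∘ β) (Sum.map sym Apart-sym A) (Apart-sym B))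
        (inj₂ (A , refl)) → decide (ℕ.<⇒≤ 1+b<e)
          (follow-from-1+b 1+a<b 1+b<e 1+c<d 1+d<e 1+a<d 1+c<b inj β A refl)
          (follow-from-1+b 1+c<d 1+d<e 1+a<b 1+b<e 1+c<b 1+a<d inj (swap ∘ β) (Apart-sym A) refl)
      where
      β : ∀ u → toℕ (f u) ≡ up a b e (toℕ u) ⊎ toℕ (f u) ≡ up c d e (toℕ u)
      β u = Sum.map (λ h → trans (cong toℕ h) (toℕ-next a b e 1+a<b 1+b<e u))
                    (λ h → trans (cong toℕ h) (toℕ-next c d e 1+c<d 1+d<e u)) (btw u)

      Along : (ℕ → ℕ) → ℕ → Set
      Along s k = ∀ u → toℕ u ≡ k → toℕ (f u) ≡ s k

      along : ∀ {s k u} → toℕ u ≡ k → toℕ (f u) ≡ s (toℕ u) → Along s k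
      along {s} p h v q = trans (cong (toℕ ∘ f) (Fin.toℕ-injective (trans q (sym p)))) (trans h (cong s p))

      decide : ∀ {k} → k ≤ e → (Along (up a b e) k → ∀ l → Along (up a b e) l) →
               (Along (up c d e) k → ∀ l → Along (up c d e) l) → f ≗ next x ⊎ f ≗ next y
      decide k≤e F G with u , u≡k ← city k≤e with β u
      ... | inj₁ h = inj₁ λ v → Fin.toℕ-injective (trans (F (along u≡k h) _ v refl) (sym (toℕ-next a b e 1+a<b 1+b<e v)))
      ... | inj₂ h = inj₂ λ v → Fin.toℕ-injective (trans (G (along u≡k h) _ v refl) (sym (toℕ-next c d e 1+c<d 1+d<e v)))

-- Distinct even numbers begin disjoint pairs of consecutive numbers, which is what `Apart` asks
-- for.
even-apart : ∀ i j → i ≢ j → Apart (2 * i) (2 * j)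
even-apart i j h = h ∘ ℕ.*-cancelˡ-≡ i j 2 , ℕ.even≢odd i j , ≢-sym (ℕ.even≢odd j i)

module _ (k : ℕ) {e : ℕ} (4k≤e : 4 * k ≤ e) where
  private
    A B : Fin k → ℕ
    -- All `A i` lie below 2k and all `B j` from 2k up to below 4k, so every `A i` can be combined
    -- with every `B j`.
    A i = 2 * toℕ i
    B j = 2 * (k + toℕ j)

    1+2i<2l : ∀ {i l} → i < l → 1 + 2 * i < 2 * l
    1+2i<2l {i} {l} i<l = ℕ.≤-trans (ℕ.≤-reflexive (sym (ℕ.*-suc 2 i))) (ℕ.*-monoʳ-≤ 2 i<l)

    A<B : ∀ i j → 1 + A i < B j
    A<B i j = 1+2i<2l (ℕ.<-≤-trans (Fin.toℕ<n i) (ℕ.m≤m+n k (toℕ j)))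

    B<e : ∀ j → 1 + B j < e
    B<e j = ℕ.<-≤-trans (1+2i<2l (ℕ.+-monoʳ-< k (Fin.toℕ<n j)))
      (ℕ.≤-trans (ℕ.≤-reflexive (trans (cong (2 *_) (cong (k +_) (sym (ℕ.+-identityʳ k)))) (sym (ℕ.*-assoc 2 2 k)))) 4k≤e)

    apart : ∀ {i j} s → i ≢ j → Apart (2 * (s + toℕ {k} i)) (2 * (s + toℕ j))
    apart s h = even-apart _ _ (h ∘ Fin.toℕ-injective ∘ ℕ.+-cancelˡ-≡ s _ _)

    positions : Fin (k * k) → Fin k × Fin k
    positions = remQuot k

    member : Fin k × Fin k → PSBTour (suc e)
    member (i , j) = toPSB (detour (A i) (B j) e (A<B i j) (B<e j))

    members-adjacent : ∀ p q → p ≢ q → Adjacent (member p) (member q)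
    members-adjacent (i , j) (i′ , j′) p≢q =
      detours-adjacent (A<B i j) (B<e j) (A<B i′ j′) (B<e j′) (A<B i j′) (A<B i′ j)
        (case i Fin.≟ i′ of λ where
          (no i≢)    → case j Fin.≟ j′ of λ where
            (no j≢)    → inj₁ (inj₂ (apart 0 i≢) , apart k j≢)
            (yes refl) → inj₂ (apart 0 i≢ , refl)
          (yes refl) → inj₁ (inj₁ refl , apart k λ { refl → p≢q refl }))

  square-clique : Clique (suc e) (k * k)
  square-clique = member ∘ positions , λ p q p≢q → members-adjacent (positions p) (positions q) λ eq →
    p≢q (trans (sym (Fin.combine-remQuot {k} k p)) (trans (cong (λ (i , j) → combine i j) eq) (Fin.combine-remQuot {k} k q)))

clique-lower : ∀ e → 4 ≤ e → ∃ λ m → Clique (suc e) m × suc e ^ 2 ≤ 64 * m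
clique-lower e 4≤e = k * k , square-clique k 4k≤e , bound
  where
  k = e / 4
  4k≤e : 4 * k ≤ e
  4k≤e = subst (_≤ e) (ℕ.*-comm k 4) (m/n*n≤m e 4)
  double : ∀ k → 4 * k + k * 4 ≡ 8 * k
  double = solve-∀
  square : ∀ k → 8 * k * (8 * k * 1) ≡ 64 * (k * k)
  square = solve-∀
  -- As 4 ≤ e gives k ≥ 1, the remainder costs at most 4 ≤ 4k; squaring 8k yields the constant 64.
  n≤8k : suc e ≤ 8 * k
  n≤8k = begin
    suc e                ≡⟨ cong suc (m≡m%n+[m/n]*n e 4) ⟩
    suc (e % 4 + k * 4)  ≤⟨ ℕ.+-monoˡ-≤ (k * 4) (m%n<n e 4) ⟩
    4 + k * 4            ≤⟨ ℕ.+-monoˡ-≤ (k * 4) (ℕ.*-monoʳ-≤ 4 (m≥n⇒m/n>0 4≤e)) ⟩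
    4 * k + k * 4        ≡⟨ double k ⟩
    8 * k                ∎
    where open ℕ.≤-Reasoning
  bound : suc e ^ 2 ≤ 64 * (k * k)
  bound = begin
    suc e ^ 2      ≤⟨ ℕ.^-monoˡ-≤ 2 n≤8k ⟩
    (8 * k) ^ 2    ≡⟨ square k ⟩
    64 * (k * k)   ∎
    where open ℕ.≤-Reasoning

theorem4 : ∃ λ (a : ℕ) → ∃ λ (b : ℕ) → ∃ λ (n₀ : ℕ) →
    NonZero a × NonZero b ×
    (∀ n → n₀ ≤ n →
    (∃ λ m → Clique n m × n ^ 2 ≤ a * m) ×
    (∀ m → Clique n m → m ≤ b * n ^ 2))
-- Five cities make the largest label at least 4, as `clique-lower` requires.
theorem4 = 64 , (2 ^ 4) ^ 4 , 5 , _ , _ , λ where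
  (suc (suc n)) (s≤s 4≤e) → clique-lower (suc n) 4≤e , clique-upper n
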